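{- Let $n \geq 4$ be an integer. Then the square $Q_n^2$ of the hypercube $Q_n$ is an automorphic graph if and only if $n$ is an even integer.
   Context: All graphs are finite, simple and undirected. The hypercube $Q_n$ is the graph with vertex set $\{0,1\}^n$ in which two $n$-tuples are adjacent if and only if they differ in precisely one coordinate. For a graph $\Gamma=(V,E)$, the square $\Gamma^2$ is the simple graph with vertex set $V$ in which two distinct vertices are adjacent if and only if their distance in $\Gamma$ is at most two. A graph $\Gamma$ is distance-transitive if for all vertices $u,v,x,y$ of $\Gamma$ with $d(u,v)=d(x,y)$ (graph distance in $\Gamma$) there is an automorphism $\pi$ of $\Gamma$ such that $\pi(u)=x$ and $\pi(v)=y$. A block in the action of a group $G$ on a set $X$ is a subset $B\subseteq X$ such that $B\cap g(B)\in\{B,\emptyset\}$ for each $g\in G$. If $G$ is transitive on $X$, the action is primitive if the only blocks are those of cardinality $0$, $1$ or $|X|$. The line graph $L(\Delta)$ of a graph $\Delta$ has the edges of $\Delta$ as vertices, two of them being adjacent whenever the corresponding (distinct) edges of $\Delta$ have a common vertex; a graph is a line graph if it is isomorphic to $L(\Delta)$ for some graph $\Delta$. An automorphic graph is a distance-transitive graph whose automorphism group acts primitively on its vertices, and which is not a complete graph or a line graph. -}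

module Defs where

open import Data.Bool using (Bool; true; false)
import Data.Bool.Properties as Bool
import Data.Fin.Properties as Fin
open import Data.List using (List; []; _∷_; length; filter; deduplicate; concatMap; cartesianProductWith)
open import Data.List.Membership.Propositional.Properties using (∈-cartesianProductWith⁺)
open import Data.List.Membership.Propositional using (_∈_)
open import Data.List.Membership.Setoid.Properties using (∈-deduplicate⁺)
open import Data.List.Relation.Unary.All using ([]; _∷_)
open import Data.List.Relation.Unary.AllPairs using ([]; _∷_)
open import Data.List.Relation.Unary.Any as Any using (Any; here; there)
open import Data.List.Relation.Unary.Any.Properties using (concatMap⁺)
open import Data.List.Relation.Unary.Enumerates.Setoid using (IsEnumeration)
open import Data.List.Relation.Unary.Unique.DecSetoid.Properties using (deduplicate-!)
import Data.List.Relation.Unary.Unique.Propositional as Propositional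
open import Data.List.Relation.Unary.Unique.Propositional.Properties using (cartesianProductWith⁺)
open import Data.List.Relation.Unary.Unique.Setoid using (Unique)
open import Data.Nat using (ℕ; zero; suc; _≤_; s≤s)
open import Data.Nat.Properties using (≮⇒≥; <⇒≱; allUpTo?; anyUpTo?)
open import Data.Product using (∃; ∃-syntax; Σ-syntax; ∃!; _×_; _,_; proj₁; proj₂)
open import Data.Sum as Sum using (_⊎_; inj₁; inj₂)
open import Data.Vec using (Vec; []; _∷_; lookup)
open import Data.Vec.Properties using (≡-dec; ∷-injective)
open import Function using (_∘_)
open import Function.Bundles using (Inverse; _⇔_)
open import Level using (0ℓ) renaming (suc to lsuc)
open import Relation.Binary.Bundles using (DecSetoid)
open import Relation.Binary.Core using (Rel)
open import Relation.Binary.Definitions using (Symmetric; Transitive; Irreflexive; Decidable; _Respects_; _Respects₂_)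
open import Relation.Binary.PropositionalEquality as ≡ using (_≡_; _≢_; refl)
open import Relation.Nullary using (¬_; Dec; yes; no)
open import Relation.Nullary.Decidable using (map′; ¬?; _×-dec_; _⊎-dec_; _→-dec_)
open import Relation.Unary as U using (Pred; Empty; _∩_; _≐_)

-- Finite simple undirected graphs.  The vertices form a decidable setoid, so
-- that unordered pairs (the vertices of a line graph) can be represented by
-- ordered pairs up to swapping.  Finiteness is a repetition-free list of all
-- vertices.
record Graph : Set (lsuc 0ℓ) where
  infix 4 _~_ _~?_
  field
    vertexSetoid : DecSetoid 0ℓ 0ℓ

  open DecSetoid vertexSetoid public
    using (_≈_; _≟_; setoid)
    renaming (Carrier to Vertex; refl to ≈-refl; sym to ≈-sym; trans to ≈-trans)

  field
    _~_             : Rel Vertex 0ℓ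
    _~?_            : Decidable _~_
    ~-resp-≈        : _~_ Respects₂ _≈_
    ~-sym           : Symmetric _~_
    ~-irrefl        : Irreflexive _≈_ _~_
    vertices        : List Vertex
    vertices-all    : IsEnumeration setoid vertices
    vertices-unique : Unique setoid vertices

  order : ℕ
  order = length vertices

  ∃? : ∀ {P : Pred Vertex 0ℓ} → P Respects _≈_ → U.Decidable P → Dec (∃ P)
  ∃? {P} resp P? = map′ Any.satisfied
    (λ (v , pv) → Any.map (λ v≈x → resp v≈x pv) (vertices-all v))
    (Any.any? P? vertices)

  Walk : ℕ → Rel Vertex 0ℓ
  Walk zero    u v = u ≈ v
  Walk (suc k) u v = ∃[ w ] (u ~ w × Walk k w v)

  Walk-respˡ : ∀ k {u u′ v} → u ≈ u′ → Walk k u v → Walk k u′ v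
  Walk-respˡ zero    u≈u′ u≈v             = ≈-trans (≈-sym u≈u′) u≈v
  Walk-respˡ (suc k) u≈u′ (w , u~w , w⋯v) = w , proj₂ ~-resp-≈ u≈u′ u~w , w⋯v

  Walk-respʳ : ∀ k {u v v′} → v ≈ v′ → Walk k u v → Walk k u v′
  Walk-respʳ zero    v≈v′ u≈v             = ≈-trans u≈v v≈v′
  Walk-respʳ (suc k) v≈v′ (w , u~w , w⋯v) = w , u~w , Walk-respʳ k v≈v′ w⋯v

  Walk-snoc : ∀ k {u v w} → Walk k u v → v ~ w → Walk (suc k) u w
  Walk-snoc zero    {w = w} u≈v v~w =
    w , proj₂ ~-resp-≈ (≈-sym u≈v) v~w , ≈-refl
  Walk-snoc (suc k) (x , u~x , x⋯v) v~w = x , u~x , Walk-snoc k x⋯v v~w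

  Walk-sym : ∀ k → Symmetric (Walk k)
  Walk-sym zero    u≈v             = ≈-sym u≈v
  Walk-sym (suc k) (w , u~w , w⋯v) = Walk-snoc k (Walk-sym k w⋯v) (~-sym u~w)

  Walk? : ∀ k → Decidable (Walk k)
  Walk? zero    u v = u ≟ v
  Walk? (suc k) u v = ∃?
    (λ x≈y (u~x , x⋯v) → proj₁ ~-resp-≈ x≈y u~x , Walk-respˡ k x≈y x⋯v)
    (λ w → (u ~? w) ×-dec Walk? k w v)

  -- The relation d(u,v) = k.  No k satisfies it when u and v lie in different
  -- components (distance infinity).
  Distance : Vertex → Vertex → ℕ → Set
  Distance u v k = Walk k u v × (∀ j → Walk j u v → k ≤ j)

  Distance? : ∀ u v k → Dec (Distance u v k)
  Distance? u v k = map′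
    (λ (w , min) → w , λ j wj → ≮⇒≥ λ j<k → min j<k wj)
    (λ (w , min) → w , λ {j} j<k wj → <⇒≱ j<k (min j wj))
    (Walk? k u v ×-dec allUpTo? (λ j → ¬? (Walk? j u v)) k)

  Distance-resp : ∀ {u u′ v v′ k} → u ≈ u′ → v ≈ v′ → Distance u v k → Distance u′ v′ k
  Distance-resp {k = k} p q (w , min) =
    Walk-respʳ k q (Walk-respˡ k p w) ,
    λ j w′ → min j (Walk-respʳ j (≈-sym q) (Walk-respˡ j (≈-sym p) w′))

  Distance-sym : ∀ {u v k} → Distance u v k → Distance v u k
  Distance-sym {k = k} (w , min) = Walk-sym k w , λ j w′ → min j (Walk-sym j w′)

  -- d(u,v) = d(x,y), both possibly infinite
  SameDistance : (u v x y : Vertex) → Set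
  SameDistance u v x y = ∀ k → Distance u v k ⇔ Distance x y k

-- Every subset of a finite set is classically decidable; a subset also has to
-- respect the equality of vertices.
record Subset (Γ : Graph) : Set (lsuc 0ℓ) where
  open Graph Γ
  field
    member  : Pred Vertex 0ℓ
    resp    : member Respects _≈_
    member? : U.Decidable member

  cardinality : ℕ
  cardinality = length (filter member? vertices)

infix 4 _≅_
record _≅_ (Γ Δ : Graph) : Set where
  private
    module Γ = Graph Γ
    module Δ = Graph Δ
  field
    bijection : Inverse Γ.setoid Δ.setoid

  open Inverse bijection public using (to; from; to-cong; from-cong; inverse)

  field
    preserves : ∀ u v → (u Γ.~ v) ⇔ (to u Δ.~ to v)

Automorphism : Graph → Set
Automorphism Γ = Γ ≅ Γ

_² : Graph → Graph
Γ ² = record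
  { vertexSetoid    = vertexSetoid
  ; _~_             = λ u v → ¬ (u ≈ v) × ∃[ k ] (k ≤ 2 × Distance u v k)
  ; _~?_            = λ u v → ¬? (u ≟ v) ×-dec map′
      (λ { (k , s≤s k≤2 , d) → k , k≤2 , d })
      (λ (k , k≤2 , d) → k , s≤s k≤2 , d)
      (anyUpTo? (Distance? u v) 3)
  ; ~-resp-≈        =
      (λ v≈v′ (u≉v , k , k≤2 , d) →
         (λ u≈v′ → u≉v (≈-trans u≈v′ (≈-sym v≈v′))) ,
         k , k≤2 , Distance-resp ≈-refl v≈v′ d) ,
      (λ u≈u′ (u≉v , k , k≤2 , d) →
         (λ u′≈v → u≉v (≈-trans u≈u′ u′≈v)) ,
         k , k≤2 , Distance-resp u≈u′ ≈-refl d)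
  ; ~-sym           = λ (u≉v , k , k≤2 , d) → u≉v ∘ ≈-sym , k , k≤2 , Distance-sym d
  ; ~-irrefl        = λ u≈v (u≉v , _) → u≉v u≈v
  ; vertices        = vertices
  ; vertices-all    = vertices-all
  ; vertices-unique = vertices-unique
  }
  where open Graph Γ

module LineGraph (Δ : Graph) where
  open Graph Δ

  record Edge : Set where
    constructor edge
    field
      src tgt  : Vertex
      adjacent : src ~ tgt
  open Edge

  infix 4 _≈ₑ_ _≟ₑ_ _∈ₑ_ _∈ₑ?_

  data _≈ₑ_ (e f : Edge) : Set where
    same    : src e ≈ src f → tgt e ≈ tgt f → e ≈ₑ f
    swapped : src e ≈ tgt f → tgt e ≈ src f → e ≈ₑ f

  _≟ₑ_ : Decidable _≈ₑ_
  e ≟ₑ f = map′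
    (λ { (inj₁ (p , q)) → same p q ; (inj₂ (p , q)) → swapped p q })
    (λ { (same p q) → inj₁ (p , q) ; (swapped p q) → inj₂ (p , q) })
    (((src e ≟ src f) ×-dec (tgt e ≟ tgt f)) ⊎-dec
     ((src e ≟ tgt f) ×-dec (tgt e ≟ src f)))

  ≈ₑ-refl : ∀ {e} → e ≈ₑ e
  ≈ₑ-refl = same ≈-refl ≈-refl

  ≈ₑ-sym : Symmetric _≈ₑ_
  ≈ₑ-sym (same    p q) = same    (≈-sym p) (≈-sym q)
  ≈ₑ-sym (swapped p q) = swapped (≈-sym q) (≈-sym p)

  ≈ₑ-trans : Transitive _≈ₑ_
  ≈ₑ-trans (same    p q) (same    r s) = same    (≈-trans p r) (≈-trans q s)
  ≈ₑ-trans (same    p q) (swapped r s) = swapped (≈-trans p r) (≈-trans q s)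
  ≈ₑ-trans (swapped p q) (same    r s) = swapped (≈-trans p s) (≈-trans q r)
  ≈ₑ-trans (swapped p q) (swapped r s) = same    (≈-trans p s) (≈-trans q r)

  edgeSetoid : DecSetoid 0ℓ 0ℓ
  edgeSetoid = record
    { Carrier          = Edge
    ; _≈_              = _≈ₑ_
    ; isDecEquivalence = record
      { isEquivalence = record { refl = ≈ₑ-refl ; sym = ≈ₑ-sym ; trans = ≈ₑ-trans }
      ; _≟_           = _≟ₑ_
      }
    }

  _∈ₑ_ : Vertex → Edge → Set
  x ∈ₑ e = x ≈ src e ⊎ x ≈ tgt e

  _∈ₑ?_ : ∀ x e → Dec (x ∈ₑ e)
  x ∈ₑ? e = (x ≟ src e) ⊎-dec (x ≟ tgt e)

  ∈ₑ-respˡ : ∀ {e} → (_∈ₑ e) Respects _≈_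
  ∈ₑ-respˡ x≈y = Sum.map (≈-trans (≈-sym x≈y)) (≈-trans (≈-sym x≈y))

  ∈ₑ-respʳ : ∀ {x} → (x ∈ₑ_) Respects _≈ₑ_
  ∈ₑ-respʳ (same    p q) (inj₁ r) = inj₁ (≈-trans r p)
  ∈ₑ-respʳ (same    p q) (inj₂ r) = inj₂ (≈-trans r q)
  ∈ₑ-respʳ (swapped p q) (inj₁ r) = inj₂ (≈-trans r p)
  ∈ₑ-respʳ (swapped p q) (inj₂ r) = inj₁ (≈-trans r q)

  edge? : Vertex → Vertex → List Edge
  edge? u v with u ~? v
  ... | yes u~v = edge u v u~v ∷ []
  ... | no  _   = []

  ∈-edge? : ∀ e {u v} → src e ≈ u → tgt e ≈ v → Any (e ≈ₑ_) (edge? u v)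
  ∈-edge? e {u} {v} p q with u ~? v
  ... | yes _  = here (same p q)
  ... | no u≁v with () ← u≁v (proj₁ ~-resp-≈ q (proj₂ ~-resp-≈ p (adjacent e)))

  -- with repetitions: every edge occurs in both orientations
  orientedEdges : List Edge
  orientedEdges = concatMap (λ u → concatMap (edge? u) vertices) vertices

  orientedEdges-all : ∀ e → Any (e ≈ₑ_) orientedEdges
  orientedEdges-all e =
    concatMap⁺ (λ u → concatMap (edge? u) vertices)
      (Any.map (λ {u} p → concatMap⁺ (edge? u)
        (Any.map (λ {v} q → ∈-edge? e p q) (vertices-all (tgt e))))
      (vertices-all (src e)))

  L : Graph
  L = record
    { vertexSetoid    = edgeSetoid
    ; _~_             = λ e f → ¬ (e ≈ₑ f) × ∃[ x ] (x ∈ₑ e × x ∈ₑ f)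
    ; _~?_            = λ e f → ¬? (e ≟ₑ f) ×-dec
        ∃? (λ x≈y (p , q) → ∈ₑ-respˡ {e} x≈y p , ∈ₑ-respˡ {f} x≈y q)
           (λ x → (x ∈ₑ? e) ×-dec (x ∈ₑ? f))
    ; ~-resp-≈        =
        (λ f≈f′ (e≉f , x , p , q) →
           (λ e≈f′ → e≉f (≈ₑ-trans e≈f′ (≈ₑ-sym f≈f′))) , x , p , ∈ₑ-respʳ f≈f′ q) ,
        (λ e≈e′ (e≉f , x , p , q) →
           (λ e′≈f → e≉f (≈ₑ-trans e≈e′ e′≈f)) , x , ∈ₑ-respʳ e≈e′ p , q)
    ; ~-sym           = λ (e≉f , x , p , q) → e≉f ∘ ≈ₑ-sym , x , q , p
    ; ~-irrefl        = λ e≈f (e≉f , _) → e≉f e≈f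
    ; vertices        = deduplicate _≟ₑ_ orientedEdges
    ; vertices-all    = λ e →
        ∈-deduplicate⁺ (DecSetoid.setoid edgeSetoid) _≟ₑ_
          (λ f≈g e≈g → ≈ₑ-trans e≈g (≈ₑ-sym f≈g)) (orientedEdges-all e)
    ; vertices-unique = deduplicate-! edgeSetoid orientedEdges
    }

open LineGraph public using (L)

IsLineGraph : Graph → Set (lsuc 0ℓ)
IsLineGraph Γ = ∃[ Δ ] (Γ ≅ L Δ)

module _ (Γ : Graph) where
  open Graph Γ
  open _≅_

  IsComplete : Set
  IsComplete = ∀ u v → ¬ (u ≈ v) → u ~ v

  IsDistanceTransitive : Set
  IsDistanceTransitive = ∀ u v x y → SameDistance u v x y →
    Σ[ π ∈ Automorphism Γ ] (to π u ≈ x × to π v ≈ y)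

  image : Automorphism Γ → Pred Vertex 0ℓ → Pred Vertex 0ℓ
  image π B x = ∃[ b ] (B b × to π b ≈ x)

  IsBlock : Subset Γ → Set
  IsBlock B = ∀ π → (member ∩ image π member ≐ member) ⊎ Empty (member ∩ image π member)
    where open Subset B

  IsTransitive : Set
  IsTransitive = ∀ u v → Σ[ π ∈ Automorphism Γ ] (to π u ≈ v)

  IsPrimitive : Set (lsuc 0ℓ)
  IsPrimitive = IsTransitive ×
    (∀ B → IsBlock B → let open Subset B in
      cardinality ≡ 0 ⊎ cardinality ≡ 1 ⊎ cardinality ≡ order)

  IsAutomorphic : Set (lsuc 0ℓ)
  IsAutomorphic = IsDistanceTransitive × IsPrimitive × ¬ (IsComplete ⊎ IsLineGraph Γ)

bits : List Bool
bits = false ∷ true ∷ []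

tuples : ∀ n → List (Vec Bool n)
tuples zero    = [] ∷ []
tuples (suc n) = cartesianProductWith _∷_ bits (tuples n)

tuples-all : ∀ {n} (v : Vec Bool n) → v ∈ tuples n
tuples-all []      = here refl
tuples-all (b ∷ v) = ∈-cartesianProductWith⁺ _∷_ (bits-all b) (tuples-all v)
  where
  bits-all : ∀ b → b ∈ bits
  bits-all false = here refl
  bits-all true  = there (here refl)

tuples-unique : ∀ n → Propositional.Unique (tuples n)
tuples-unique zero    = [] ∷ []
tuples-unique (suc n) = cartesianProductWith⁺ _∷_ ∷-injective
  (((λ ()) ∷ []) ∷ [] ∷ []) (tuples-unique n)

Q : ℕ → Graph
Q n = record
  { vertexSetoid    = ≡.decSetoid (≡-dec Bool._≟_)
  ; _~_             = λ (u v : Vec Bool n) → ∃! _≡_ λ i → lookup u i ≢ lookup v i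
  ; _~?_            = λ u v → Fin.any? λ i →
      ¬? (lookup u i Bool.≟ lookup v i) ×-dec
      map′ (λ h {j} → h j) (λ h j → h {j})
        (Fin.all? λ j → ¬? (lookup u j Bool.≟ lookup v j) →-dec (i Fin.≟ j))
  ; ~-resp-≈        = ≡.resp₂ _
  ; ~-sym           = λ (i , u≢v , unique) → i , u≢v ∘ ≡.sym , λ v≢u → unique (v≢u ∘ ≡.sym)
  ; ~-irrefl        = λ { refl (i , u≢u , _) → u≢u refl }
  ; vertices        = tuples n
  ; vertices-all    = tuples-all
  ; vertices-unique = tuples-unique n
  }

{-# OPTIONS --safe #-}

-- Prefixing a parity bit identifies Q n ² with the graph of even-weight vectors of
-- length n + 1, two of them adjacent when they differ in exactly two places.  Its
-- distance is half the Hamming distance, and translations together with the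
-- permutations of all n + 1 coordinates act distance-transitively.
--
-- n odd: the antipode is the unique vertex at maximal distance, so {⊥ , ⊤} is a block.
--
-- n even: by distance-transitivity a block with two points at distance k contains
-- everything at distance k from each of its points.  As 2 k < n + 1, two vectors of
-- weight 2 k may differ in exactly two places, so the block is closed under adjacency,
-- and Q n ² is connected.
--
-- Q n ² is not a line graph: the neighbours of an edge e in a line graph are covered by
-- two cliques (the edges at either end of e), so their non-adjacency graph has no
-- 5-cycle, whereas {0,1}, {2,3}, {4,0}, {1,2}, {3,4} is one among the neighbours of ⊥
-- (pairs of coordinates, 0 being the parity bit).
module Submission where

open import Defs
open import Data.Bool using (Bool; true; false; not; _xor_)
open import Data.Bool.Properties as Bool using (xor-comm; xor-same; xor-identityʳ;
  xor-annihilates-not; not-distribˡ-xor; not-distribʳ-xor; not-involutive)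
open import Data.Fin using (zero; suc)
open import Data.Fin.Properties using (suc-injective)
open import Data.Fin.Subset using (∣_∣; ⊥; ⊤)
open import Data.Fin.Subset.Properties using (∣p∣≤n; ∣⊥∣≡0; ∣⊤∣≡n; ∣p∣≡n⇒p≡⊤)
open import Data.List using (List; []; _∷_; length; filter)
open import Data.List.Membership.Propositional using (_∈_; lose)
open import Data.List.Membership.Propositional.Properties using (∈-filter⁺)
open import Data.List.Properties using (filter-all; filter-notAll)
open import Data.List.Relation.Unary.All as All using (All; []; _∷_)
open import Data.List.Relation.Unary.All.Properties using (all-filter)
open import Data.List.Relation.Unary.AllPairs using (_∷_)
open import Data.List.Relation.Unary.Any using (here)
open import Data.List.Relation.Unary.Unique.Propositional using (Unique)
open import Data.List.Relation.Unary.Unique.Propositional.Properties using (filter⁺)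
open import Data.Nat using (ℕ; zero; suc; _+_; _*_; _≤_; _<_; _≥_; z≤n; s≤s; s≤s⁻¹; ⌈_/2⌉)
open import Data.Nat.Divisibility using (_∣_; divides)
open import Data.Nat.Properties as ℕ using (≤-refl; ≤-trans; ≤-antisym; ≤-reflexive)
open import Data.Product using (Σ-syntax; ∃-syntax; ∃₂; _×_; _,_; proj₁; proj₂)
open import Data.Sum as Sum using (_⊎_; inj₁; inj₂; [_,_]′)
open import Data.Vec using (Vec; []; _∷_; tail; zipWith; lookup; _++_)
open import Data.Vec.Properties using (zipWith-comm; zipWith-identityʳ; ≡-dec)
open import Data.Vec.Relation.Binary.Pointwise.Extensional using (ext; Pointwise-≡⇒≡)
open import Function using (case_of_)
open import Function.Bundles using (_⇔_; mk⇔; Equivalence; Inverse)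
open import Function.Properties.Inverse as Inverse using ()
open import Level using (0ℓ)
open import Relation.Binary.PropositionalEquality
  using (_≡_; _≢_; refl; sym; trans; cong; cong₂; subst; module ≡-Reasoning)
open import Relation.Nullary using (¬_; yes; no; contradiction)
open import Relation.Nullary.Decidable using (decidable-stable; _⊎-dec_)
open import Relation.Unary as U using (Pred)

open _≅_

private variable
  n m k : ℕ
  A : Set

-- Graph distances and isomorphisms

module _ (Γ : Graph) where
  open Graph Γ

  -- Recognises `δ` as the graph distance: by `δ-step` no walk is shorter than `δ`, and iterating
  -- `descend` builds a walk of exactly that length.
  module Metric (δ : Vertex → Vertex → ℕ)
    (δ-refl  : ∀ {u v} → u ≈ v → δ u v ≡ 0)
    (δ-zero  : ∀ {u v} → δ u v ≡ 0 → u ≈ v)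
    (δ-step  : ∀ u v w → u ~ w → δ u v ≤ suc (δ w v))
    (descend : ∀ {k} u v → δ u v ≡ suc k → ∃[ w ] (u ~ w × δ w v ≡ k)) where

    Walk⇒≤ : ∀ k {u v} → Walk k u v → δ u v ≤ k
    Walk⇒≤ zero    u≈v             = ≤-reflexive (δ-refl u≈v)
    Walk⇒≤ (suc k) (w , u~w , w⋯v) = ≤-trans (δ-step _ _ w u~w) (s≤s (Walk⇒≤ k w⋯v))

    geodesic : ∀ k {u v} → δ u v ≡ k → Walk k u v
    geodesic zero    eq = δ-zero eq
    geodesic (suc k) eq with w , u~w , eq′ ← descend _ _ eq = w , u~w , geodesic k eq′

    distance : ∀ u v → Distance u v (δ u v)
    distance u v = geodesic _ refl , λ j → Walk⇒≤ j

    distance-unique : ∀ {u v k} → Distance u v k → δ u v ≡ k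
    distance-unique (w , min) = ≤-antisym (Walk⇒≤ _ w) (min _ (geodesic _ refl))

≅-sym : ∀ {Γ Δ} → Γ ≅ Δ → Δ ≅ Γ
≅-sym {Γ} {Δ} φ = record
  { bijection = Inverse.sym (bijection φ)
  ; preserves = λ a b → mk⇔
      (λ a~b → Equivalence.from (preserves φ _ _)
        (~-resp (Δ.≈-sym (to∘from a)) (Δ.≈-sym (to∘from b)) a~b))
      (λ p → ~-resp (to∘from a) (to∘from b) (Equivalence.to (preserves φ _ _) p))
  }
  where
  module Δ = Graph Δ
  to∘from : ∀ a → to φ (from φ a) Δ.≈ a
  to∘from = Inverse.strictlyInverseˡ (bijection φ)
  ~-resp : ∀ {a a′ b b′} → a Δ.≈ a′ → b Δ.≈ b′ → a Δ.~ b → a′ Δ.~ b′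
  ~-resp p q a~b = proj₁ Δ.~-resp-≈ q (proj₂ Δ.~-resp-≈ p a~b)

module _ {Γ Δ : Graph} where
  private
    module Γ = Graph Γ
    module Δ = Graph Δ

  Walk-map : (φ : Γ ≅ Δ) → ∀ k {u v} → Γ.Walk k u v → Δ.Walk k (to φ u) (to φ v)
  Walk-map φ zero    u≈v             = to-cong φ u≈v
  Walk-map φ (suc k) (w , u~w , w⋯v) =
    to φ w , Equivalence.to (preserves φ _ _) u~w , Walk-map φ k w⋯v

  from∘to : (φ : Γ ≅ Δ) → ∀ u → from φ (to φ u) Γ.≈ u
  from∘to φ = Inverse.strictlyInverseʳ (bijection φ)

  to-injective : (φ : Γ ≅ Δ) → ∀ {u v} → to φ u Δ.≈ to φ v → u Γ.≈ v
  to-injective φ p =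
    Γ.≈-trans (Γ.≈-sym (from∘to φ _)) (Γ.≈-trans (from-cong φ p) (from∘to φ _))

Distance-map : ∀ {Γ Δ} (φ : Γ ≅ Δ) {u v k} →
  Graph.Distance Γ u v k → Graph.Distance Δ (to φ u) (to φ v) k
Distance-map {Γ} φ {k = k} (w , min) = Walk-map φ k w , λ j w′ → min j
  (Walk-respʳ j (from∘to φ _) (Walk-respˡ j (from∘to φ _) (Walk-map (≅-sym φ) j w′)))
  where open Graph Γ

-- Line graphs

-- Adjacency in the complement graph.
Apart : (Γ : Graph) → Graph.Vertex Γ → Graph.Vertex Γ → Set
Apart Γ u v = ¬ (u ≈ v) × ¬ (u ~ v)
  where open Graph Γ

Apart-map : ∀ {Γ Δ} (φ : Γ ≅ Δ) {u v} → Apart Γ u v → Apart Δ (to φ u) (to φ v)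
Apart-map φ (u≉v , u≁v) =
  (λ p → u≉v (to-injective φ p)) , λ p → u≁v (Equivalence.from (preserves φ _ _) p)

module _ (Δ : Graph) where
  open Graph Δ using (_≈_; ≈-sym)
  open LineGraph Δ hiding (L)
  open Edge

  shares-endpoint : ∀ {e f} → Graph._~_ (L Δ) e f → src e ∈ₑ f ⊎ tgt e ∈ₑ f
  shares-endpoint {e} {f} (_ , x , x∈e , x∈f) =
    Sum.map (λ p → ∈ₑ-respˡ {f} p x∈f) (λ p → ∈ₑ-respˡ {f} p x∈f) x∈e

  apart⇒disjoint : ∀ {x e f} → Apart (L Δ) e f → x ∈ₑ e → ¬ (x ∈ₑ f)
  apart⇒disjoint (e≉f , e≁f) x∈e x∈f = e≁f (e≉f , _ , x∈e , x∈f)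

module _ (Γ : Graph) where
  open Graph Γ using (_~_)

  -- Each neighbour of `c` becomes an edge through an end of `to φ c`, and edges that are apart
  -- share no end. The two ends would thus alternate around a cycle of odd length.
  apart-pentagon⇒¬line : ∀ c a₀ a₁ a₂ a₃ a₄ →
    c ~ a₀ → c ~ a₁ → c ~ a₂ → c ~ a₃ → c ~ a₄ →
    Apart Γ a₀ a₁ → Apart Γ a₁ a₂ → Apart Γ a₂ a₃ → Apart Γ a₃ a₄ → Apart Γ a₄ a₀ →
    ¬ IsLineGraph Γ
  apart-pentagon⇒¬line c _ _ _ _ _ c₀ c₁ c₂ c₃ c₄ p₀ p₁ p₂ p₃ p₄ (Δ , φ) =
    -- Either end of `to φ c` may lie on the image of `a₀`; the second case is the first with the
    -- two ends exchanged.
    [ alternate (λ {f} → colour {f})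
    , alternate (λ {f} c~f → Sum.swap (colour {f} c~f)) ]′ (colour c₀)
    where
    open LineGraph Δ hiding (L)
    open Edge

    colour : ∀ {f} → c ~ f → src (to φ c) ∈ₑ to φ f ⊎ tgt (to φ c) ∈ₑ to φ f
    colour c~f = shares-endpoint Δ (Equivalence.to (preserves φ _ _) c~f)

    switch : ∀ {x y f g} → Apart Γ f g → x ∈ₑ to φ f →
      x ∈ₑ to φ g ⊎ y ∈ₑ to φ g → y ∈ₑ to φ g
    switch p x∈f (inj₁ x∈g) = contradiction x∈g (apart⇒disjoint Δ (Apart-map φ p) x∈f)
    switch p x∈f (inj₂ y∈g) = y∈g

    alternate : ∀ {x y} → (∀ {f} → c ~ f → x ∈ₑ to φ f ⊎ y ∈ₑ to φ f) →
      ¬ (x ∈ₑ to φ _)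
    alternate col x∈₀ =
      let y∈₁ = switch p₀ x∈₀ (col c₁)
          x∈₂ = switch p₁ y∈₁ (Sum.swap (col c₂))
          y∈₃ = switch p₂ x∈₂ (col c₃)
          x∈₄ = switch p₃ y∈₃ (Sum.swap (col c₄))
      in apart⇒disjoint Δ (Apart-map φ p₄) x∈₄ x∈₀

-- Bit vectors under addition modulo 2

infixl 6 _⊕_
_⊕_ : Vec Bool n → Vec Bool n → Vec Bool n
_⊕_ = zipWith _xor_

⊕-comm : (u v : Vec Bool n) → u ⊕ v ≡ v ⊕ u
⊕-comm = zipWith-comm xor-comm

⊕-self : (u : Vec Bool n) → u ⊕ u ≡ ⊥
⊕-self []      = refl
⊕-self (b ∷ u) = cong₂ _∷_ (xor-same b) (⊕-self u)

⊕-identityʳ : (u : Vec Bool n) → u ⊕ ⊥ ≡ u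
⊕-identityʳ = zipWith-identityʳ xor-identityʳ

⊕-identityˡ : (u : Vec Bool n) → ⊥ ⊕ u ≡ u
⊕-identityˡ u = trans (⊕-comm ⊥ u) (⊕-identityʳ u)

-- Translation invariance of differences, checked bit by bit; it yields the triangle inequality and
-- the isometry of `motion`.
⊕-cancel : (u v w : Vec Bool n) → (u ⊕ w) ⊕ (v ⊕ w) ≡ u ⊕ v
⊕-cancel []      []      []      = refl
⊕-cancel (a ∷ u) (b ∷ v) (c ∷ w) = cong₂ _∷_ (bit a b c) (⊕-cancel u v w)
  where
  bit : ∀ a b c → (a xor c) xor (b xor c) ≡ a xor b
  bit false b     false = xor-identityʳ b
  bit false false true  = refl
  bit false true  true  = refl
  bit true  false false = refl
  bit true  true  false = refl
  bit true  false true  = refl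
  bit true  true  true  = refl

⊕-involutive : (u w : Vec Bool n) → (u ⊕ w) ⊕ w ≡ u
⊕-involutive u w = begin
  u ⊕ w ⊕ w           ≡⟨ cong (u ⊕ w ⊕_) (⊕-identityˡ w) ⟨
  (u ⊕ w) ⊕ (⊥ ⊕ w)   ≡⟨ ⊕-cancel u ⊥ w ⟩
  u ⊕ ⊥               ≡⟨ ⊕-identityʳ u ⟩
  u                   ∎
  where open ≡-Reasoning

⊕≡⇒ : {u v w : Vec Bool n} → u ⊕ v ≡ w → v ≡ w ⊕ u
⊕≡⇒ {u = u} {v} refl = sym (trans (cong (_⊕ u) (⊕-comm u v)) (⊕-involutive v u))

⊕≡⊥⇒≡ : {u v : Vec Bool n} → u ⊕ v ≡ ⊥ → u ≡ v
⊕≡⊥⇒≡ {u = u} eq = sym (trans (⊕≡⇒ eq) (⊕-identityˡ u))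

∣p∣≡0⇒p≡⊥ : (p : Vec Bool n) → ∣ p ∣ ≡ 0 → p ≡ ⊥
∣p∣≡0⇒p≡⊥ []          _  = refl
∣p∣≡0⇒p≡⊥ (false ∷ p) eq = cong (false ∷_) (∣p∣≡0⇒p≡⊥ p eq)

∣⊕∣-≤ : (u v : Vec Bool n) → ∣ u ⊕ v ∣ ≤ ∣ u ∣ + ∣ v ∣
∣⊕∣-≤ []          []          = z≤n
∣⊕∣-≤ (false ∷ u) (false ∷ v) = ∣⊕∣-≤ u v
∣⊕∣-≤ (false ∷ u) (true  ∷ v) =
  ≤-trans (s≤s (∣⊕∣-≤ u v)) (≤-reflexive (sym (ℕ.+-suc ∣ u ∣ ∣ v ∣)))
∣⊕∣-≤ (true  ∷ u) (false ∷ v) = s≤s (∣⊕∣-≤ u v)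
∣⊕∣-≤ (true  ∷ u) (true  ∷ v) =
  ≤-trans (∣⊕∣-≤ u v) (ℕ.+-mono-≤ (ℕ.n≤1+n _) (ℕ.n≤1+n _))

vector-of-weight : k ≤ n → ∃[ v ] ∣_∣ {n} v ≡ k
vector-of-weight {n = n} z≤n = ⊥ , ∣⊥∣≡0 n
vector-of-weight (s≤s k≤n) with v , eq ← vector-of-weight k≤n = true ∷ v , cong suc eq

-- The metrics of Q n and Q n ²

hamming : Vec Bool n → Vec Bool n → ℕ
hamming u v = ∣ u ⊕ v ∣

hamming-refl : (u : Vec Bool n) → hamming u u ≡ 0
hamming-refl {n} u = trans (cong ∣_∣ (⊕-self u)) (∣⊥∣≡0 n)

hamming-zero : {u v : Vec Bool n} → hamming u v ≡ 0 → u ≡ v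
hamming-zero eq = ⊕≡⊥⇒≡ (∣p∣≡0⇒p≡⊥ _ eq)

hamming-triangle : (u v w : Vec Bool n) → hamming u v ≤ hamming u w + hamming w v
hamming-triangle u v w = begin
  ∣ u ⊕ v ∣                 ≡⟨ cong ∣_∣ (⊕-cancel u v w) ⟨
  ∣ (u ⊕ w) ⊕ (v ⊕ w) ∣     ≤⟨ ∣⊕∣-≤ (u ⊕ w) (v ⊕ w) ⟩
  ∣ u ⊕ w ∣ + ∣ v ⊕ w ∣     ≡⟨ cong (λ z → ∣ u ⊕ w ∣ + ∣ z ∣) (⊕-comm v w) ⟩
  ∣ u ⊕ w ∣ + ∣ w ⊕ v ∣     ∎
  where open ℕ.≤-Reasoning

module _ {n : ℕ} where
  open Graph (Q n) public using () renaming (_~_ to _~₁_)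
  open Graph (Q n ²) public using () renaming (_~_ to _~₂_)

~₁-∷ : ∀ b {u v : Vec Bool n} → u ~₁ v → (b ∷ u) ~₁ (b ∷ v)
~₁-∷ b (i , ne , unique) = suc i , ne , λ
  { {zero}  b≢b → contradiction refl b≢b
  ; {suc j} ne′ → cong suc (unique ne′) }

~₁-head : ∀ {a b} (u : Vec Bool n) → a ≢ b → (a ∷ u) ~₁ (b ∷ u)
~₁-head u a≢b = zero , a≢b , λ
  { {zero}  _   → refl
  ; {suc j} u≢u → contradiction refl u≢u }

~₁⇒hamming≤1 : {u v : Vec Bool n} → u ~₁ v → hamming u v ≤ 1
~₁⇒hamming≤1 {u = a ∷ u} {b ∷ v} (zero , _ , unique) = begin
  ∣ (a xor b) ∷ (u ⊕ v) ∣   ≤⟨ head≤1 (a xor b) (u ⊕ v) ⟩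
  suc ∣ u ⊕ v ∣             ≡⟨ cong (λ z → suc ∣ u ⊕ z ∣) u≡v ⟨
  suc ∣ u ⊕ u ∣             ≡⟨ cong suc (hamming-refl u) ⟩
  1                         ∎
  where
  open ℕ.≤-Reasoning
  head≤1 : ∀ c (w : Vec Bool n) → ∣ c ∷ w ∣ ≤ suc ∣ w ∣
  head≤1 false w = ℕ.n≤1+n _
  head≤1 true  w = ≤-refl
  -- The heads already differ, so a difference at `j` in the tails would force `zero ≡ suc j`.
  u≡v : u ≡ v
  u≡v = Pointwise-≡⇒≡ (ext λ j →
    decidable-stable (lookup u j Bool.≟ lookup v j) λ ne → case unique {suc j} ne of λ ())
~₁⇒hamming≤1 {u = a ∷ u} {b ∷ v} (suc i , ne , unique) with a Bool.≟ b
... | no  a≢b with () ← unique {zero} a≢b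
... | yes refl rewrite xor-same a =
  ~₁⇒hamming≤1 {u = u} {v} (i , ne , λ {j} ne′ → suc-injective (unique {suc j} ne′))

-- The vertex `w` is `u` with the first coordinate that differs from `v` flipped.
hamming-descend : (u v : Vec Bool n) → hamming u v ≡ suc k →
  ∃[ w ] (u ~₁ w × hamming w v ≡ k)
hamming-descend (false ∷ u) (false ∷ v) eq
  with w , u~w , eq′ ← hamming-descend u v eq =
  false ∷ w , ~₁-∷ false u~w , eq′
hamming-descend (true  ∷ u) (true  ∷ v) eq
  with w , u~w , eq′ ← hamming-descend u v eq =
  true ∷ w , ~₁-∷ true u~w , eq′
hamming-descend (false ∷ u) (true  ∷ v) eq =
  true ∷ u , ~₁-head u (λ ()) , ℕ.suc-injective eq
hamming-descend (true  ∷ u) (false ∷ v) eq =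
  false ∷ u , ~₁-head u (λ ()) , ℕ.suc-injective eq
hamming-descend [] [] ()

≡⇒hamming≡0 : {u v : Vec Bool n} → u ≡ v → hamming u v ≡ 0
≡⇒hamming≡0 {u = u} refl = hamming-refl u

hamming-step : (u v w : Vec Bool n) → u ~₁ w → hamming u v ≤ suc (hamming w v)
hamming-step u v w u~w =
  ≤-trans (hamming-triangle u v w) (ℕ.+-monoˡ-≤ _ (~₁⇒hamming≤1 {u = u} {w} u~w))

module Q-metric (n : ℕ) =
  Metric (Q n) hamming ≡⇒hamming≡0 hamming-zero hamming-step hamming-descend

-- One step of `Q n ²` covers up to two steps of `Q n`, hence the rounding up.
halfHamming : Vec Bool n → Vec Bool n → ℕ
halfHamming u v = ⌈ hamming u v /2⌉

⌈m/2⌉≡0⇒m≡0 : ∀ m → ⌈ m /2⌉ ≡ 0 → m ≡ 0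
⌈m/2⌉≡0⇒m≡0 zero _ = refl

⌈m/2⌉≤1⇒m≤2 : ∀ m → ⌈ m /2⌉ ≤ 1 → m ≤ 2
⌈m/2⌉≤1⇒m≤2 zero                _        = z≤n
⌈m/2⌉≤1⇒m≤2 (suc zero)          _        = s≤s z≤n
⌈m/2⌉≤1⇒m≤2 (suc (suc zero))    _        = ≤-refl
⌈m/2⌉≤1⇒m≤2 (suc (suc (suc m))) (s≤s ())

halfHamming-refl : (u : Vec Bool n) → halfHamming u u ≡ 0
halfHamming-refl u = cong ⌈_/2⌉ (hamming-refl u)

halfHamming-zero : {u v : Vec Bool n} → halfHamming u v ≡ 0 → u ≡ v
halfHamming-zero eq = hamming-zero (⌈m/2⌉≡0⇒m≡0 _ eq)

~₂⇒hamming≤2 : {u v : Vec Bool n} → u ~₂ v → hamming u v ≤ 2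
~₂⇒hamming≤2 {n} (_ , k , k≤2 , d) =
  ≤-trans (≤-reflexive (Q-metric.distance-unique n d)) k≤2

hamming≤2⇒~₂ : {u v : Vec Bool n} → u ≢ v → hamming u v ≤ 2 → u ~₂ v
hamming≤2⇒~₂ {n} u≢v h≤2 = u≢v , _ , h≤2 , Q-metric.distance n _ _

~₂⇒halfHamming≡1 : {u v : Vec Bool n} → u ~₂ v → halfHamming u v ≡ 1
~₂⇒halfHamming≡1 {u = u} {v} u~v = ≤-antisym
  (ℕ.⌈n/2⌉-mono (~₂⇒hamming≤2 {u = u} {v} u~v))
  (ℕ.n≢0⇒n>0 λ eq → proj₁ u~v (halfHamming-zero eq))

halfHamming≡1⇒~₂ : {u v : Vec Bool n} → halfHamming u v ≡ 1 → u ~₂ v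
halfHamming≡1⇒~₂ {u = u} {v} eq = hamming≤2⇒~₂
  (λ { refl → case trans (sym eq) (halfHamming-refl u) of λ () })
  (⌈m/2⌉≤1⇒m≤2 _ (≤-reflexive eq))

halfHamming≡2⇒Apart : {u v : Vec Bool n} → halfHamming u v ≡ 2 → Apart (Q n ²) u v
halfHamming≡2⇒Apart {u = u} {v} eq =
  (λ { refl → case trans (sym eq) (halfHamming-refl u) of λ () }) ,
  (λ u~v → case trans (sym eq) (~₂⇒halfHamming≡1 {u = u} {v} u~v) of λ ())

-- Two consecutive uses of `hamming-descend` make one step of `Q n ²`. At Hamming distance one there
-- is no room for two, and the step goes to `v` itself.
halfHamming-descend : (u v : Vec Bool n) → halfHamming u v ≡ suc k →
  ∃[ w ] (u ~₂ w × halfHamming w v ≡ k)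
halfHamming-descend u v eq with hamming u v in h
halfHamming-descend u v refl | suc zero =
  v , hamming≤2⇒~₂ (λ { refl → case trans (sym h) (hamming-refl u) of λ () })
        (≤-trans (≤-reflexive h) (s≤s z≤n)) ,
  halfHamming-refl v
halfHamming-descend {n} u v refl | suc (suc j)
  with x , u~x , h₁ ← hamming-descend u v h
  with w , x~w , h₂ ← hamming-descend x v h₁ =
  w , hamming≤2⇒~₂ u≢w (Q-metric.Walk⇒≤ n 2 {u} {w} (x , u~x , w , x~w , refl)) , cong ⌈_/2⌉ h₂
  where
  u≢w : u ≢ w
  -- The Hamming distances to `v` are `j` from `w` and `suc (suc j)` from `u`.
  u≢w refl = ℕ.<⇒≢ (s≤s (ℕ.n≤1+n j)) (trans (sym h₂) h)

≡⇒halfHamming≡0 : {u v : Vec Bool n} → u ≡ v → halfHamming u v ≡ 0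
≡⇒halfHamming≡0 {u = u} refl = halfHamming-refl u

halfHamming-step : (u v w : Vec Bool n) → u ~₂ w → halfHamming u v ≤ suc (halfHamming w v)
halfHamming-step u v w u~w = ℕ.⌈n/2⌉-mono
  (≤-trans (hamming-triangle u v w) (ℕ.+-monoˡ-≤ _ (~₂⇒hamming≤2 {u = u} {w} u~w)))

module Q²-metric (n : ℕ) =
  Metric (Q n ²) halfHamming ≡⇒halfHamming≡0 halfHamming-zero
    halfHamming-step halfHamming-descend

-- Coordinate permutations

infixr 5 _⨾_

-- Words in transpositions of neighbouring coordinates: facts about `act` need checking on
-- generators only, and inverses come from reversing words.
data Perm : ℕ → Set where
  idₚ  : Perm n
  skip : Perm n → Perm (suc n)
  swap : Perm (suc (suc n))
  _⨾_  : Perm n → Perm n → Perm n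

act : Perm n → Vec A n → Vec A n
act idₚ      v           = v
act (skip p) (a ∷ v)     = a ∷ act p v
act swap     (a ∷ b ∷ v) = b ∷ a ∷ v
act (p ⨾ q)  v           = act q (act p v)

inv : Perm n → Perm n
inv idₚ      = idₚ
inv (skip p) = skip (inv p)
inv swap     = swap
inv (p ⨾ q)  = inv q ⨾ inv p

act-inv : ∀ (p : Perm n) (v : Vec A n) → act (inv p) (act p v) ≡ v
act-inv idₚ      v           = refl
act-inv (skip p) (a ∷ v)     = cong (a ∷_) (act-inv p v)
act-inv swap     (a ∷ b ∷ v) = refl
act-inv (p ⨾ q)  v           = trans (cong (act (inv p)) (act-inv q (act p v))) (act-inv p v)

inv-act : ∀ (p : Perm n) (v : Vec A n) → act p (act (inv p) v) ≡ v
inv-act idₚ      v           = refl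
inv-act (skip p) (a ∷ v)     = cong (a ∷_) (inv-act p v)
inv-act swap     (a ∷ b ∷ v) = refl
inv-act (p ⨾ q)  v           = trans (cong (act q) (inv-act p (act (inv q) v))) (inv-act q v)

act-⊕ : ∀ (p : Perm n) u v → act p (u ⊕ v) ≡ act p u ⊕ act p v
act-⊕ idₚ      u           v           = refl
act-⊕ (skip p) (a ∷ u)     (b ∷ v)     = cong ((a xor b) ∷_) (act-⊕ p u v)
act-⊕ swap     (a ∷ b ∷ u) (c ∷ d ∷ v) = refl
act-⊕ (p ⨾ q)  u           v           =
  trans (cong (act q) (act-⊕ p u v)) (act-⊕ q (act p u) (act p v))

∣act∣ : ∀ (p : Perm n) v → ∣ act p v ∣ ≡ ∣ v ∣
∣act∣ idₚ      v                   = refl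
∣act∣ (skip p) (false ∷ v)         = ∣act∣ p v
∣act∣ (skip p) (true  ∷ v)         = cong suc (∣act∣ p v)
∣act∣ swap     (false ∷ false ∷ v) = refl
∣act∣ swap     (false ∷ true  ∷ v) = refl
∣act∣ swap     (true  ∷ false ∷ v) = refl
∣act∣ swap     (true  ∷ true  ∷ v) = refl
∣act∣ (p ⨾ q)  v                   = trans (∣act∣ q (act p v)) (∣act∣ p v)

true-first : ∀ (v : Vec Bool (suc n)) → ∣ v ∣ ≡ suc k →
  ∃₂ λ p w → act p v ≡ true ∷ w × ∣ w ∣ ≡ k
true-first         (true  ∷ v) eq = idₚ , v , refl , ℕ.suc-injective eq
true-first {zero}  (false ∷ []) ()
true-first {suc n} (false ∷ v) eq with p , w , eq′ , ∣w∣ ← true-first v eq =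
  skip p ⨾ swap , false ∷ w , cong (λ z → act swap (false ∷ z)) eq′ , ∣w∣

-- When the heads differ, the vector starting with `false` has a `true` further on; `true-first`
-- brings it to the front and leaves tails of equal weight.
weight-transitive : ∀ (u v : Vec Bool n) → ∣ u ∣ ≡ ∣ v ∣ → ∃[ p ] act p u ≡ v
weight-transitive []          []          _  = idₚ , refl
weight-transitive (false ∷ u) (false ∷ v) eq with p , eq′ ← weight-transitive u v eq =
  skip p , cong (false ∷_) eq′
weight-transitive (true  ∷ u) (true  ∷ v) eq
  with p , eq′ ← weight-transitive u v (ℕ.suc-injective eq) =
  skip p , cong (true ∷_) eq′
weight-transitive (false ∷ u) (true  ∷ v) eq
  with p , w , eq₁ , ∣w∣ ← true-first (false ∷ u) eq
  with q , refl ← weight-transitive w v ∣w∣ =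
  p ⨾ skip q , cong (act (skip q)) eq₁
weight-transitive (true  ∷ u) (false ∷ v) eq
  with p , w , eq₁ , ∣w∣ ← true-first (false ∷ v) (sym eq)
  with q , refl ← weight-transitive u w (sym ∣w∣) =
  -- Here `p` rearranges the target rather than the source, so it is run backwards.
  skip q ⨾ inv p , trans (cong (act (inv p)) (sym eq₁)) (act-inv p (false ∷ v))

-- The parity bit

odd : ℕ → Bool
odd zero    = false
odd (suc n) = not (odd n)

odd-∷ : ∀ b (v : Vec Bool n) → odd ∣ b ∷ v ∣ ≡ b xor odd ∣ v ∣
odd-∷ false v = refl
odd-∷ true  v = refl

odd-⊕ : (u v : Vec Bool n) → odd ∣ u ⊕ v ∣ ≡ odd ∣ u ∣ xor odd ∣ v ∣
odd-⊕ []          []          = refl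
odd-⊕ (false ∷ u) (false ∷ v) = odd-⊕ u v
odd-⊕ (false ∷ u) (true  ∷ v) =
  trans (cong not (odd-⊕ u v)) (not-distribʳ-xor (odd ∣ u ∣) (odd ∣ v ∣))
odd-⊕ (true  ∷ u) (false ∷ v) =
  trans (cong not (odd-⊕ u v)) (not-distribˡ-xor (odd ∣ u ∣) (odd ∣ v ∣))
odd-⊕ (true  ∷ u) (true  ∷ v) =
  trans (odd-⊕ u v) (sym (xor-annihilates-not (odd ∣ u ∣) (odd ∣ v ∣)))

encode : Vec Bool n → Vec Bool (suc n)
encode v = odd ∣ v ∣ ∷ v

encode-⊕ : (u v : Vec Bool n) → encode (u ⊕ v) ≡ encode u ⊕ encode v
encode-⊕ u v = cong (_∷ u ⊕ v) (odd-⊕ u v)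

encode-even : (v : Vec Bool n) → odd ∣ encode v ∣ ≡ false
encode-even v = trans (odd-∷ (odd ∣ v ∣) v) (xor-same (odd ∣ v ∣))

encode-tail : (w : Vec Bool (suc n)) → odd ∣ w ∣ ≡ false → encode (tail w) ≡ w
encode-tail (false ∷ w) eq = cong (_∷ w) eq
encode-tail (true  ∷ w) eq =
  cong (_∷ w) (trans (sym (not-involutive (odd ∣ w ∣))) (cong not eq))

-- The parity bit rounds the weight up to an even number, so encoded weight and half weight
-- determine each other.
∣encode∣ : (v : Vec Bool n) → ∣ encode v ∣ ≡ ⌈ ∣ v ∣ /2⌉ + ⌈ ∣ v ∣ /2⌉
∣encode∣ v = trans (∣∷∣ (odd ∣ v ∣) v) (round-up ∣ v ∣)
  where
  ∣∷∣ : ∀ b (v : Vec Bool n) → ∣ b ∷ v ∣ ≡ ∣ b ∷ [] ∣ + ∣ v ∣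
  ∣∷∣ false v = refl
  ∣∷∣ true  v = refl
  round-up : ∀ m → ∣ odd m ∷ [] ∣ + m ≡ ⌈ m /2⌉ + ⌈ m /2⌉
  round-up zero          = refl
  round-up (suc zero)    = refl
  round-up (suc (suc m))
    rewrite not-involutive (odd m)
          | ℕ.+-suc ∣ odd m ∷ [] ∣ (suc m) | ℕ.+-suc ∣ odd m ∷ [] ∣ m
          | ℕ.+-suc ⌈ m /2⌉ ⌈ m /2⌉
    = cong (λ z → suc (suc z)) (round-up m)

-- Since `tail` undoes `encode`, this carries the permutations of all `n + 1` coordinates over to
-- the vertices of `Q n ²`.
move : Perm (suc n) → Vec Bool n → Vec Bool n
move p v = tail (act p (encode v))

-- Permuting coordinates keeps the weight, hence its evenness, so the permuted vector is again an
-- encoding.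
encode-move : ∀ (p : Perm (suc n)) v → encode (move p v) ≡ act p (encode v)
encode-move p v = encode-tail _ (trans (cong odd (∣act∣ p (encode v))) (encode-even v))

move-⊕ : ∀ (p : Perm (suc n)) u v → move p (u ⊕ v) ≡ move p u ⊕ move p v
move-⊕ p u v = trans
  (cong tail (trans (cong (act p) (encode-⊕ u v)) (act-⊕ p (encode u) (encode v))))
  (tail-⊕ (act p (encode u)) (act p (encode v)))
  where
  tail-⊕ : (x y : Vec Bool (suc n)) → tail (x ⊕ y) ≡ tail x ⊕ tail y
  tail-⊕ (a ∷ x) (b ∷ y) = refl

move-inverse : ∀ (p q : Perm (suc n)) → (∀ w → act q (act p w) ≡ w) →
  ∀ v → move q (move p v) ≡ v
move-inverse p q q∘p v = cong tail (trans (cong (act q) (encode-move p v)) (q∘p (encode v)))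

move-halfWeight : ∀ (p : Perm (suc n)) v → ⌈ ∣ move p v ∣ /2⌉ ≡ ⌈ ∣ v ∣ /2⌉
move-halfWeight p v = begin
  h′                       ≡⟨ ℕ.n≡⌈n+n/2⌉ h′ ⟩
  ⌈ h′ + h′ /2⌉            ≡⟨ cong ⌈_/2⌉ (∣encode∣ (move p v)) ⟨
  ⌈ ∣ encode (move p v) ∣ /2⌉ ≡⟨ cong (λ z → ⌈ ∣ z ∣ /2⌉) (encode-move p v) ⟩
  ⌈ ∣ act p (encode v) ∣ /2⌉  ≡⟨ cong ⌈_/2⌉ (∣act∣ p (encode v)) ⟩
  ⌈ ∣ encode v ∣ /2⌉          ≡⟨ cong ⌈_/2⌉ (∣encode∣ v) ⟩
  ⌈ h + h /2⌉              ≡⟨ ℕ.n≡⌈n+n/2⌉ h ⟨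
  h                        ∎
  where
  open ≡-Reasoning
  h′ h : ℕ
  h′ = ⌈ ∣ move p v ∣ /2⌉
  h  = ⌈ ∣ v ∣ /2⌉

-- Distance-transitivity

-- Translate `x` to `⊥`, permute, then translate `⊥` to `y`. The inverse has the same form with `x`
-- and `y` exchanged.
motion : Perm (suc n) → (x y z : Vec Bool n) → Vec Bool n
motion p x y z = move p (z ⊕ x) ⊕ y

motion-base : ∀ (p : Perm (suc n)) x y → motion p x y x ≡ y
motion-base p x y = begin
  move p (x ⊕ x) ⊕ y           ≡⟨ cong (_⊕ y) (move-⊕ p x x) ⟩
  (move p x ⊕ move p x) ⊕ y    ≡⟨ cong (_⊕ y) (⊕-self (move p x)) ⟩
  ⊥ ⊕ y                        ≡⟨ ⊕-identityˡ y ⟩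
  y                            ∎
  where open ≡-Reasoning

motion-inverse : ∀ (p q : Perm (suc n)) → (∀ w → act q (act p w) ≡ w) →
  ∀ x y z → motion q y x (motion p x y z) ≡ z
motion-inverse p q q∘p x y z = begin
  move q ((move p (z ⊕ x) ⊕ y) ⊕ y) ⊕ x
    ≡⟨ cong (λ w → move q w ⊕ x) (⊕-involutive _ y) ⟩
  move q (move p (z ⊕ x)) ⊕ x
    ≡⟨ cong (_⊕ x) (move-inverse p q q∘p (z ⊕ x)) ⟩
  (z ⊕ x) ⊕ x
    ≡⟨ ⊕-involutive z x ⟩
  z ∎
  where open ≡-Reasoning

motion-isometry : ∀ (p : Perm (suc n)) x y u v →
  halfHamming (motion p x y u) (motion p x y v) ≡ halfHamming u v
motion-isometry p x y u v = begin
  ⌈ ∣ (move p (u ⊕ x) ⊕ y) ⊕ (move p (v ⊕ x) ⊕ y) ∣ /2⌉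
    ≡⟨ cong (λ z → ⌈ ∣ z ∣ /2⌉) (⊕-cancel (move p (u ⊕ x)) (move p (v ⊕ x)) y) ⟩
  ⌈ ∣ move p (u ⊕ x) ⊕ move p (v ⊕ x) ∣ /2⌉
    ≡⟨ cong (λ z → ⌈ ∣ z ∣ /2⌉) (move-⊕ p (u ⊕ x) (v ⊕ x)) ⟨
  ⌈ ∣ move p ((u ⊕ x) ⊕ (v ⊕ x)) ∣ /2⌉
    ≡⟨ move-halfWeight p _ ⟩
  ⌈ ∣ (u ⊕ x) ⊕ (v ⊕ x) ∣ /2⌉
    ≡⟨ cong (λ z → ⌈ ∣ z ∣ /2⌉) (⊕-cancel u v x) ⟩
  ⌈ ∣ u ⊕ v ∣ /2⌉ ∎
  where open ≡-Reasoning

motion-automorphism : Perm (suc n) → (x y : Vec Bool n) → Automorphism (Q n ²)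
motion-automorphism p x y = record
  { bijection = record
    { to        = motion p x y
    ; from      = motion (inv p) y x
    ; to-cong   = cong (motion p x y)
    ; from-cong = cong (motion (inv p) y x)
    ; inverse   =
        (λ { refl → motion-inverse (inv p) p (inv-act p) y x _ }) ,
        (λ { refl → motion-inverse p (inv p) (act-inv p) x y _ })
    }
  ; preserves = λ u v → mk⇔
      (λ u~v → halfHamming≡1⇒~₂
        (trans (motion-isometry p x y u v) (~₂⇒halfHamming≡1 {u = u} {v} u~v)))
      (λ u~v → halfHamming≡1⇒~₂
        (trans (sym (motion-isometry p x y u v)) (~₂⇒halfHamming≡1 u~v)))
  }

Q²-transitive : IsTransitive (Q n ²)
Q²-transitive u v = motion-automorphism idₚ u v , motion-base idₚ u v

-- A motion based at `u` and `x` sends `u` to `x` for every `p`, so `p` is chosen to carry the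
-- encoded difference `v ⊕ u` to that of `y ⊕ x`; the two have equal weight.
halfHamming-transitive : (u v x y : Vec Bool n) → halfHamming u v ≡ halfHamming x y →
  Σ[ π ∈ Automorphism (Q n ²) ] (to π u ≡ x × to π v ≡ y)
halfHamming-transitive u v x y eq =
  let p , act-eq = weight-transitive (encode (v ⊕ u)) (encode (y ⊕ x)) weights in
  motion-automorphism p u x , motion-base p u x , (begin
    move p (v ⊕ u) ⊕ x   ≡⟨ cong (λ z → tail z ⊕ x) act-eq ⟩
    (y ⊕ x) ⊕ x          ≡⟨ ⊕-involutive y x ⟩
    y                    ∎)
  where
  open ≡-Reasoning
  weights : ∣ encode (v ⊕ u) ∣ ≡ ∣ encode (y ⊕ x) ∣
  weights = begin
    ∣ encode (v ⊕ u) ∣                      ≡⟨ ∣encode∣ (v ⊕ u) ⟩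
    ⌈ ∣ v ⊕ u ∣ /2⌉ + ⌈ ∣ v ⊕ u ∣ /2⌉       ≡⟨ cong (λ k → k + k) eq′ ⟩
    ⌈ ∣ y ⊕ x ∣ /2⌉ + ⌈ ∣ y ⊕ x ∣ /2⌉       ≡⟨ ∣encode∣ (y ⊕ x) ⟨
    ∣ encode (y ⊕ x) ∣                      ∎
    where
    eq′ : halfHamming v u ≡ halfHamming y x
    eq′ rewrite ⊕-comm v u | ⊕-comm y x = eq

Q²-distance-transitive : IsDistanceTransitive (Q n ²)
Q²-distance-transitive {n} u v x y same = halfHamming-transitive u v x y
  (sym (distance-unique (Equivalence.to (same _) (distance u v))))
  where open Q²-metric n

automorphism-isometry : (π : Automorphism (Q n ²)) (u v : Vec Bool n) →
  halfHamming (to π u) (to π v) ≡ halfHamming u v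
automorphism-isometry {n} π u v = distance-unique (Distance-map π (distance u v))
  where open Q²-metric n

-- Blocks

module _ {P : Pred A 0ℓ} (P? : U.Decidable P) {xs : List A} where

  length-filter≡0 : ∀ {x} → x ∈ xs → P x → length (filter P? xs) ≢ 0
  length-filter≡0 x∈ px eq with filter P? xs | ∈-filter⁺ P? x∈ px
  length-filter≡0 x∈ px () | _ ∷ _ | _

  length-filter≡1 : ∀ {x y} → x ∈ xs → y ∈ xs → P x → P y →
    length (filter P? xs) ≡ 1 → x ≡ y
  length-filter≡1 x∈ y∈ px py eq
    with filter P? xs | ∈-filter⁺ P? x∈ px | ∈-filter⁺ P? y∈ py
  length-filter≡1 x∈ y∈ px py refl | _ ∷ [] | here refl | here refl = refl

  length-filter≥2 : Unique xs → 2 ≤ length (filter P? xs) → ∃₂ λ x y → x ≢ y × P x × P y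
  length-filter≥2 xs! 2≤ with filter P? xs | filter⁺ P? xs! | all-filter P? xs
  length-filter≥2 xs! (s≤s ()) | _ ∷ []    | _               | _
  length-filter≥2 xs! _        | x ∷ y ∷ _ | (x≢y ∷ _) ∷ _   | px ∷ py ∷ _ =
    x , y , x≢y , px , py

module _ (B : Subset (Q n ²)) (block : IsBlock (Q n ²) B) where
  open Subset B

  -- Take `π` with `x ↦ u` and `y ↦ v`. The block meets its image in `u`, so it lies inside that
  -- image; hence `v` is the image of a member, which injectivity identifies with `y`.
  block-closed : ∀ {u v x} → member u → member v → member x →
    ∀ y → halfHamming x y ≡ halfHamming u v → member y
  block-closed {u} {v} {x} u∈B v∈B x∈B y eq
    with π , πx≡u , πy≡v ← halfHamming-transitive x y u v eq
    with block π
  ... | inj₂ empty = contradiction (u∈B , x , x∈B , πx≡u) (empty u)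
  ... | inj₁ (_ , B⊆) with _ , b , b∈B , πb≡v ← B⊆ v∈B =
    subst member (to-injective π (trans πb≡v (sym πy≡v))) b∈B

  adjacent-pair⇒full : ∀ {u v} → member u → member v → halfHamming u v ≡ 1 →
    ∀ x → member x
  adjacent-pair⇒full {u} {v} u∈B v∈B eq x =
    along (halfHamming u x) u∈B (proj₁ (Q²-metric.distance n u x))
    where
    along : ∀ k {x y} → member x → Graph.Walk (Q n ²) k x y → member y
    along zero    x∈B refl            = x∈B
    along (suc k) {x} x∈B (w , x~w , w⋯y) = along k
      (block-closed u∈B v∈B x∈B w (trans (~₂⇒halfHamming≡1 {u = x} {w} x~w) (sym eq))) w⋯y

-- Half of an even `n` needs no rounding up. This is where evenness enters `block-full`.
halfHamming-bound : ∀ q → n ≡ q * 2 → (u v : Vec Bool n) →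
  halfHamming u v + halfHamming u v ≤ n
halfHamming-bound {n} q refl u v = begin
  h + h      ≤⟨ ℕ.+-mono-≤ h≤q h≤q ⟩
  q + q      ≡⟨ q+q≡q*2 ⟩
  q * 2      ∎
  where
  open ℕ.≤-Reasoning
  h : ℕ
  h = halfHamming u v
  q+q≡q*2 : q + q ≡ q * 2
  q+q≡q*2 = sym (trans (ℕ.*-comm q 2) (cong (q +_) (ℕ.+-identityʳ q)))
  h≤q : h ≤ q
  h≤q = begin
    h              ≤⟨ ℕ.⌈n/2⌉-mono (∣p∣≤n (u ⊕ v)) ⟩
    ⌈ q * 2 /2⌉    ≡⟨ cong ⌈_/2⌉ q+q≡q*2 ⟨
    ⌈ q + q /2⌉    ≡⟨ ℕ.n≡⌈n+n/2⌉ q ⟨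
    q              ∎

-- With `suc k` the distance of `u` and `v`, the weights `2k + 1` of `s` and `2k + 2` of `t` both
-- round to half weight `suc k`, while `s` and `t` differ in one coordinate. So `s ⊕ u` and `t ⊕ u`
-- are adjacent members.
block-full : 2 ∣ n → (B : Subset (Q n ²)) → IsBlock (Q n ²) B →
  let open Subset B in ∀ {u v} → u ≢ v → member u → member v → ∀ x → member x
block-full {zero} _ _ _ {[]} {[]} u≢v = contradiction refl u≢v
block-full {suc n} (divides q n≡2q) B block {u} {v} u≢v u∈B v∈B with halfHamming u v in eq
... | zero  = contradiction (halfHamming-zero eq) u≢v
... | suc k = adjacent-pair⇒full B block
  (step s halfWeight-s) (step t halfWeight-t)
  (trans (cong (λ z → ⌈ ∣ z ∣ /2⌉) (⊕-cancel s t u))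
         (cong (λ j → ⌈ suc j /2⌉) (hamming-refl r)))
  where
  open Subset B
  step : ∀ s → ⌈ ∣ s ∣ /2⌉ ≡ suc k → member (s ⊕ u)
  step s ∣s∣ = block-closed B block u∈B v∈B u∈B (s ⊕ u)
    (trans (cong (λ z → ⌈ ∣ z ∣ /2⌉) (trans (⊕-comm u (s ⊕ u)) (⊕-involutive s u)))
      (trans ∣s∣ (sym eq)))
  -- The dimension is `suc n` in this clause; one coordinate is reserved for the heads of `s` and
  -- `t`.
  2k+1≤n : suc (k + k) ≤ n
  2k+1≤n = ≤-trans (≤-reflexive (sym (ℕ.+-suc k k)))
    (s≤s⁻¹ (subst (λ h → h + h ≤ suc n) eq (halfHamming-bound q n≡2q u v)))
  r : Vec Bool n
  r = proj₁ (vector-of-weight 2k+1≤n)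
  ∣r∣ : ∣ r ∣ ≡ suc (k + k)
  ∣r∣ = proj₂ (vector-of-weight 2k+1≤n)
  -- With parity bits, s and t are true ∷ false ∷ r and false ∷ true ∷ r.
  s t : Vec Bool (suc n)
  s = false ∷ r
  t = true ∷ r
  halfWeight-s : ⌈ ∣ s ∣ /2⌉ ≡ suc k
  halfWeight-s = trans (cong ⌈_/2⌉ ∣r∣) (cong suc (sym (ℕ.n≡⌊n+n/2⌋ k)))
  halfWeight-t : ⌈ ∣ t ∣ /2⌉ ≡ suc k
  halfWeight-t = trans (cong (λ j → ⌈ suc j /2⌉) ∣r∣) (cong suc (sym (ℕ.n≡⌈n+n/2⌉ k)))

even⇒primitive : 2 ∣ n → IsPrimitive (Q n ²)
even⇒primitive {n} 2∣n = Q²-transitive , trichotomy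
  where
  trichotomy : ∀ B → IsBlock (Q n ²) B → let open Subset B in
    cardinality ≡ 0 ⊎ cardinality ≡ 1 ⊎ cardinality ≡ Graph.order (Q n ²)
  trichotomy B block with Subset.cardinality B in card
  ... | zero        = inj₁ refl
  ... | suc zero    = inj₂ (inj₁ refl)
  ... | suc (suc _)
    with u , v , u≢v , u∈B , v∈B ← length-filter≥2 (Subset.member? B) (tuples-unique n)
           (subst (2 ≤_) (sym card) (s≤s (s≤s z≤n)))
    = inj₂ (inj₂ (trans (sym card) (cong length (filter-all member?
        (All.universal (block-full 2∣n B block u≢v u∈B v∈B) (tuples n))))))
    where open Subset B

-- n odd: the antipodal block

module _ (m : ℕ) (n≡ : n ≡ suc (m + m)) where

  -- For `n = 2m + 1`, antipodes have half distance `m + 1`, whereas any Hamming distance below `n`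
  -- gives at most `m`; automorphisms preserve the half distance.
  automorphism-antipode : (π : Automorphism (Q n ²)) (u v : Vec Bool n) →
    u ⊕ v ≡ ⊤ → to π u ⊕ to π v ≡ ⊤
  automorphism-antipode π u v u⊕v≡⊤ =
    ∣p∣≡n⇒p≡⊤ (≤-antisym (∣p∣≤n (to π u ⊕ to π v)) (ℕ.≮⇒≥ short))
    where
    open ℕ.≤-Reasoning
    short : ¬ (hamming (to π u) (to π v) < n)
    short lt = ℕ.<-irrefl refl (begin
      suc m                          ≡⟨ cong suc (ℕ.n≡⌊n+n/2⌋ m) ⟩
      ⌈ suc (m + m) /2⌉              ≡⟨ cong ⌈_/2⌉ n≡ ⟨
      ⌈ n /2⌉                        ≡⟨ cong ⌈_/2⌉ (∣⊤∣≡n n) ⟨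
      ⌈ ∣ ⊤ {n} ∣ /2⌉                ≡⟨ cong (λ z → ⌈ ∣ z ∣ /2⌉) u⊕v≡⊤ ⟨
      halfHamming u v                ≡⟨ automorphism-isometry π u v ⟨
      halfHamming (to π u) (to π v)  ≤⟨ ℕ.⌈n/2⌉-mono hamming≤2m ⟩
      ⌈ m + m /2⌉                    ≡⟨ ℕ.n≡⌈n+n/2⌉ m ⟨
      m                              ∎)
      where
      hamming≤2m : hamming (to π u) (to π v) ≤ m + m
      hamming≤2m = s≤s⁻¹ (subst (hamming (to π u) (to π v) <_) n≡ lt)

  antipodalPair : Subset (Q n ²)
  antipodalPair = record
    { member  = λ x → x ≡ ⊥ ⊎ x ≡ ⊤
    ; resp    = λ { refl x∈ → x∈ }
    ; member? = λ x → ≡-dec Bool._≟_ x ⊥ ⊎-dec ≡-dec Bool._≟_ x ⊤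
    }

  open Subset antipodalPair

  member-antipode : ∀ {x y} → x ⊕ y ≡ ⊤ → member x → member y
  member-antipode eq (inj₁ refl) = inj₂ (trans (⊕≡⇒ eq) (⊕-identityʳ ⊤))
  member-antipode eq (inj₂ refl) = inj₁ (trans (⊕≡⇒ eq) (⊕-self ⊤))

  -- The image of the pair is again a pair of antipodes, so it equals the pair or misses it,
  -- according to where `to π ⊥` lies.
  antipodalPair-block : IsBlock (Q n ²) antipodalPair
  antipodalPair-block π with member? (to π ⊥)
  ... | yes π⊥∈ = inj₁ (proj₁ , λ x∈ → x∈ , preimage π⊥∈ x∈)
    where
    antipode : to π ⊥ ⊕ to π ⊤ ≡ ⊤
    antipode = automorphism-antipode π ⊥ ⊤ (⊕-identityˡ ⊤)
    preimage : ∀ {x} → member (to π ⊥) → member x → image (Q n ²) π member x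
    preimage (inj₁ π⊥≡⊥) (inj₁ refl) = ⊥ , inj₁ refl , π⊥≡⊥
    preimage (inj₂ π⊥≡⊤) (inj₂ refl) = ⊥ , inj₁ refl , π⊥≡⊤
    preimage (inj₁ π⊥≡⊥) (inj₂ refl) = ⊤ , inj₂ refl ,
      trans (⊕≡⇒ antipode) (trans (cong (⊤ ⊕_) π⊥≡⊥) (⊕-identityʳ ⊤))
    preimage (inj₂ π⊥≡⊤) (inj₁ refl) = ⊤ , inj₂ refl ,
      trans (⊕≡⇒ antipode) (trans (cong (⊤ ⊕_) π⊥≡⊤) (⊕-self ⊤))
  ... | no π⊥∉ = inj₂ λ
    { x (x∈ , _ , inj₁ refl , refl) → π⊥∉ x∈
    ; x (x∈ , _ , inj₂ refl , refl) →
        π⊥∉ (member-antipode (automorphism-antipode π ⊤ ⊥ (⊕-identityʳ ⊤)) x∈) }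

odd⇒¬primitive : 2 ≤ n → ∀ m → n ≡ suc (m + m) → ¬ IsPrimitive (Q n ²)
odd⇒¬primitive {suc (suc n)} (s≤s (s≤s z≤n)) m n≡ (_ , trichotomy) =
  [ length-filter≡0 member? (tuples-all ⊥) (inj₁ refl)
  , [ (λ card≡1 → case length-filter≡1 member? (tuples-all (⊥ {suc (suc n)}))
          (tuples-all ⊤) (inj₁ refl) (inj₂ refl) card≡1 of λ ())
    -- From dimension two on, `true ∷ false ∷ ⊥` is neither `⊥` nor `⊤`, so the pair is not the
    -- whole vertex set.
    , ℕ.<⇒≢ (filter-notAll member? (tuples (suc (suc n))) (lose (tuples-all (true ∷ false ∷ ⊥)) λ
        { (inj₁ ()) ; (inj₂ ()) }))
    ]′
  ]′ (trichotomy (antipodalPair m n≡) (antipodalPair-block m n≡))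
  where open Subset (antipodalPair m n≡)

-- Neither complete nor a line graph

-- Reduces distances within a fixed small configuration to closed computations, settled by `refl` in
-- every larger dimension.
halfHamming-pad : (u v : Vec Bool m) → halfHamming (u ++ ⊥ {n}) (v ++ ⊥) ≡ halfHamming u v
halfHamming-pad {n = n} u v = cong ⌈_/2⌉ (pad u v)
  where
  pad : (u v : Vec Bool m) → hamming (u ++ ⊥ {n}) (v ++ ⊥) ≡ hamming u v
  pad []          []          = hamming-refl (⊥ {n})
  pad (false ∷ u) (false ∷ v) = pad u v
  pad (false ∷ u) (true  ∷ v) = cong suc (pad u v)
  pad (true  ∷ u) (false ∷ v) = cong suc (pad u v)
  pad (true  ∷ u) (true  ∷ v) = pad u v

pad-adjacent : {u v : Vec Bool m} → halfHamming u v ≡ 1 → (u ++ ⊥ {n}) ~₂ (v ++ ⊥)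
pad-adjacent {n = n} {u} {v} eq =
  halfHamming≡1⇒~₂ {u = u ++ ⊥ {n}} {v ++ ⊥} (trans (halfHamming-pad u v) eq)

pad-apart : {u v : Vec Bool m} → halfHamming u v ≡ 2 →
  Apart (Q (m + n) ²) (u ++ ⊥ {n}) (v ++ ⊥)
pad-apart {n = n} {u = u} {v} eq =
  halfHamming≡2⇒Apart {u = u ++ ⊥ {n}} {v ++ ⊥} (trans (halfHamming-pad u v) eq)

-- Three is the least weight whose half rounds up to two.
Q²-¬complete : 3 ≤ n → ¬ IsComplete (Q n ²)
Q²-¬complete {suc (suc (suc n))} (s≤s (s≤s (s≤s z≤n))) complete =
  proj₂ apart (complete ⊥ (⊤ {3} ++ ⊥) (proj₁ apart))
  where
  apart : Apart (Q (3 + n) ²) ⊥ (⊤ {3} ++ ⊥)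
  apart = pad-apart {u = ⊥} {⊤ {3}} refl

Q²-¬line : 4 ≤ n → ¬ IsLineGraph (Q n ²)
Q²-¬line {suc (suc (suc (suc n)))} (s≤s (s≤s (s≤s (s≤s z≤n)))) =
  apart-pentagon⇒¬line (Q (4 + n) ²) ⊥
  (a₀ ++ ⊥) (a₁ ++ ⊥) (a₂ ++ ⊥) (a₃ ++ ⊥) (a₄ ++ ⊥)
  (adjacent a₀ refl) (adjacent a₁ refl) (adjacent a₂ refl) (adjacent a₃ refl)
  (adjacent a₄ refl)
  (apart a₀ a₁ refl) (apart a₁ a₂ refl) (apart a₂ a₃ refl) (apart a₃ a₄ refl)
  (apart a₄ a₀ refl)
  where
  -- The pairs `{0,1}`, `{2,3}`, `{4,0}`, `{1,2}`, `{3,4}` with the parity coordinate `0` dropped.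
  -- Cyclically consecutive pairs are disjoint, so their encodings differ in four places.
  a₀ a₁ a₂ a₃ a₄ : Vec Bool 4
  a₀ = true  ∷ false ∷ false ∷ false ∷ []
  a₁ = false ∷ true  ∷ true  ∷ false ∷ []
  a₂ = false ∷ false ∷ false ∷ true  ∷ []
  a₃ = true  ∷ true  ∷ false ∷ false ∷ []
  a₄ = false ∷ false ∷ true  ∷ true  ∷ []
  adjacent : ∀ a → halfHamming ⊥ a ≡ 1 → ⊥ ~₂ (a ++ ⊥ {n})
  adjacent a = pad-adjacent {u = ⊥} {a}
  apart : ∀ a b → halfHamming a b ≡ 2 → Apart (Q (4 + n) ²) (a ++ ⊥) (b ++ ⊥)
  apart a b = pad-apart {u = a} {b}

-- Parity of the dimension and the equivalence

even-or-odd : ∀ n → 2 ∣ n ⊎ ∃[ m ] n ≡ suc (m + m)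
even-or-odd zero          = inj₁ (divides 0 refl)
even-or-odd (suc zero)    = inj₂ (0 , refl)
even-or-odd (suc (suc n)) with even-or-odd n
... | inj₁ (divides q refl) = inj₁ (divides (suc q) refl)
... | inj₂ (m , refl)       = inj₂ (suc m , cong (λ k → suc (suc k)) (sym (ℕ.+-suc m m)))

corollary4p4 : (n : ℕ) → n ≥ 4 → IsAutomorphic (Q n ²) ⇔ 2 ∣ n
corollary4p4 n n≥4 = mk⇔ ⇒ ⇐
  where
  n≥3 : n ≥ 3
  n≥3 = ℕ.<⇒≤ n≥4
  ⇒ : IsAutomorphic (Q n ²) → 2 ∣ n
  ⇒ (_ , isPrimitive , _) with even-or-odd n
  ... | inj₁ even     = even
  ... | inj₂ (m , n≡) = contradiction isPrimitive (odd⇒¬primitive (ℕ.<⇒≤ n≥3) m n≡)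
  ⇐ : 2 ∣ n → IsAutomorphic (Q n ²)
  ⇐ even = Q²-distance-transitive , even⇒primitive even ,
    [ Q²-¬complete n≥3 , Q²-¬line n≥4 ]′
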